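{- Let $c>0$ be an integer, let $T^c$ be the initial non-one $c$-grid, and let $T^{c,i}$, $1\le i\le c$, be its row reductions. (i) For $1\le i\le c$, $t(c,i)=\frac1i\,t(c,1)$, with $t(c,1)=\frac{c}{2c+1}$. (ii) For $1\le i\le c$, the four edge-ratio relationships hold in the $i$-grid $T^{c,i}$. (iii) For $1\le i\le c-1$, $$T^{c,i}_{X,r,d}=f(c,i)\,T^{i}_{X,r,d}\qquad\text{for all } 1\le r\le i,\ 1\le d\le r,\ X\in\{L,R,B\}.$$
   Context: **Labelled grids.** For $n\ge 1$, an $n$-grid is the triangular graph made of $n$ rows of upright triangles: row $r$ ($1\le r\le n$, counted from the top) contains the upright triangles $T_{r,d}$, $1\le d\le r$, counted from the left. The edges of the graph are exactly the left, right and base edges of the upright triangles, and each edge belongs to exactly one upright triangle. A labelled $n$-grid $T$ is an assignment of positive real labels (resistances) $T_{L,r,d},T_{R,r,d},T_{B,r,d}$ to the left, right and base edges of each $T_{r,d}$, $1\le d\le r\le n$. **Edge-ratio functions.** $$r_{R,L}(r,d)=\frac{2(r-d)+1}{2d-1},\qquad r_{B,L}(n,r,d)=\frac{2(n-r)+1}{2d-1},$$ $$x(n,r)=\frac{r-1}{2r-1}\cdot\frac{2(n-r)+3}{(n-r)+1},\qquad y(r,d)=\frac{d-1}{2d-3}\cdot\frac{2(r-d)+3}{(r-d)+1}.$$ **The four edge-ratio relationships** for a labelled $n$-grid $T$ are: $T_{L,r,1}=x(n,r)\,T_{L,r-1,1}$ for $2\le r\le n$; $T_{L,r,d}=y(r,d)\,T_{L,r,d-1}$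 for $2\le d\le r\le n$; $T_{R,r,d}=r_{R,L}(r,d)\,T_{L,r,d}$ for $1\le d\le r\le n$; $T_{B,r,d}=r_{B,L}(n,r,d)\,T_{L,r,d}$ for $1\le d\le r\le n$. **Initial non-one grid.** For $m\ge1$, $T^{m}$ is the labelled $m$-grid determined by $T^m_{L,1,1}=1$ and the four edge-ratio relationships with $n=m$. **Row reduction.** Let $\Delta(u,v,w)=\frac{uv}{u+v+w}$ and $Y(u,v,w)=\frac{uv+vw+wu}{u}$. Given a labelled $n$-grid $T$ (the parent), apply the $\Delta$–Y transformation to each upright triangle, giving legs $$Y_{12,r,d}=\Delta(T_{L,r,d},T_{R,r,d},T_{B,r,d}),\quad Y_{4,r,d}=\Delta(T_{R,r,d},T_{B,r,d},T_{L,r,d}),\quad Y_{8,r,d}=\Delta(T_{B,r,d},T_{L,r,d},T_{R,r,d})$$ (from the center of the triangle to its top, lower right, lower left vertex respectively). The corner tails are $Y_{12,1,1},Y_{8,n,1},Y_{4,n,n}$. If $n\ge 2$, discard the corner tails, combine consecutive boundary legs in series, and apply the Y–$\Delta$ transformation to the remaining stars. The result is the row-reduced (child) labelled $(n-1)$-grid $T'$ with, explicitly: - $T'_{L,r,1}=Y_{8,r,1}+Y_{12,r+1,1}$ for $1\le r\le n-1$; - $T'_{R,r,r}=Y_{4,r,r}+Y_{12,r+1,r+1}$ for $1\le r\le n-1$; - $T'_{B,n-1,d}=Y_{4,n,d}+Y_{8,n,d+1}$ for $1\le d\le n-1$; - $T'_{L,r,d}=Y(Y_{4,r,d-1},Y_{8,r,d},Y_{12,r+1,d})$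 for $2\le d\le r\le n-1$; - $T'_{R,r,d}=Y(Y_{8,r,d+1},Y_{4,r,d},Y_{12,r+1,d+1})$ for $1\le d\le r-1$, $r\le n-1$; - $T'_{B,r,d}=Y(Y_{12,r+2,d+1},Y_{4,r+1,d},Y_{8,r+1,d+1})$ for $1\le d\le r\le n-2$. For $1\le i\le c$, $T^{c,i}$ is the labelled $i$-grid obtained from $T^c$ by $c-i$ consecutive row reductions (so $T^{c,c}=T^c$). **Tails.** $t(c,i)$ is the label of any corner tail arising when the $\Delta$–Y transformations are applied to $T^{c,i}$ (the three corner tails have equal labels); that is, $t(c,i)=\Delta\big(T^{c,i}_{L,1,1},T^{c,i}_{R,1,1},T^{c,i}_{B,1,1}\big)$. **The function $f$.** $f(c,i)=1+\frac{c-i}{i}\cdot\frac{1}{2c+1}$ for $1\le i\le c-1$. -}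

module Defs where

open import Level using (0ℓ) renaming (suc to lsuc; _⊔_ to _⊔ˡ_)
open import Data.Nat.Base
  using (ℕ; zero; suc; _+_; _*_; _∸_; _≤_; _<_; s≤s; z≤n; NonZero; >-nonZero;
         _≤′_; ≤′-reflexive; ≤′-step)
open import Data.Nat.Properties as ℕ
  using (m<n⇒0<n∸m; *-monoʳ-≤; ≤-trans; m≤n⇒m≤1+n; ≤∧≢⇒<; ≤⇒≤′; n≤1+n)
open import Data.Empty using (⊥-elim; ⊥-elim-irr)
open import Data.Product.Base using (_,_)
open import Data.Sum.Base using (_⊎_; inj₁; inj₂)
open import Relation.Nullary using (yes; no)
open import Relation.Binary.Core using (Rel)
open import Relation.Binary.Definitions using (tri<; tri≈; tri>)
open import Relation.Binary.Structures using (IsStrictPartialOrder)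
open import Relation.Binary.PropositionalEquality using (_≢_; refl)
open import Algebra.Bundles using (CommutativeRing)
open import Algebra.Apartness.Bundles using (HeytingField)
import Algebra.Apartness.Properties.HeytingCommutativeRing as HeytingProperties
import Algebra.Properties.Ring as RingProperties
import Algebra.Properties.Semiring.Mult as Mult
import Data.Rational as ℚ
import Data.Rational.Properties as ℚ

-- An ordered field, with apartness x # y equivalent to x < y or y < x.
-- The order is not required to be decidable, so that the real numbers
-- qualify constructively as well as classically.
record OrderedField c ℓ₁ ℓ₂ : Set (lsuc (c ⊔ˡ ℓ₁ ⊔ˡ ℓ₂)) where
  field
    heytingField : HeytingField c ℓ₁ ℓ₂
  open HeytingField heytingField public renaming (_+_ to _+ᴷ_; _*_ to _*ᴷ_)
  infix 4 _<ᴷ_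
  field
    _<ᴷ_                 : Rel Carrier ℓ₂
    isStrictPartialOrder : IsStrictPartialOrder _≈_ _<ᴷ_
    #⇒<⊎>                : ∀ {x y} → x # y → x <ᴷ y ⊎ y <ᴷ x
    <⇒#                  : ∀ {x y} → x <ᴷ y → x # y
    0<1                  : 0# <ᴷ 1#
    +-monoˡ-<            : ∀ z {x y} → x <ᴷ y → x +ᴷ z <ᴷ y +ᴷ z
    *-pos                : ∀ {x y} → 0# <ᴷ x → 0# <ᴷ y → 0# <ᴷ x *ᴷ y
  module < = IsStrictPartialOrder isStrictPartialOrder

ℚ-orderedField : OrderedField 0ℓ 0ℓ 0ℓ
ℚ-orderedField = record
  { heytingField         = ℚ.heytingField
  ; _<ᴷ_                 = ℚ._<_
  ; isStrictPartialOrder = ℚ.<-isStrictPartialOrder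
  ; #⇒<⊎>                = ≢⇒<⊎>
  ; <⇒#                  = ℚ.<⇒≢
  ; 0<1                  = ℚ.positive⁻¹ ℚ.1ℚ
  ; +-monoˡ-<            = ℚ.+-monoˡ-<
  ; *-pos                = λ {x} {y} 0<x 0<y → ℚ.positive⁻¹ (x ℚ.* y)
                             {{ℚ.pos*pos⇒pos x {{ℚ.positive 0<x}} y {{ℚ.positive 0<y}}}}
  }
  where
  ≢⇒<⊎> : ∀ {x y} → x ≢ y → x ℚ.< y ⊎ y ℚ.< x
  ≢⇒<⊎> {x} {y} x≢y with ℚ.<-cmp x y
  ... | tri< x<y _ _ = inj₁ x<y
  ... | tri≈ _ x≡y _ = ⊥-elim (x≢y x≡y)
  ... | tri> _ _ y<x = inj₂ y<x

module Positive {c ℓ₁ ℓ₂} (K : OrderedField c ℓ₁ ℓ₂) where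
  open OrderedField K
  open HeytingProperties heytingCommutativeRing using (x-0≈x; invertibleˡ⇒#)
  private
    commutativeRing : CommutativeRing c ℓ₁
    commutativeRing = record { isCommutativeRing = isCommutativeRing }
  open CommutativeRing commutativeRing using (ring; semiring)
  open RingProperties ring using (-‿distribˡ-*)
  open Mult semiring using () renaming (_×_ to _×ᴷ_)

  record K⁺ : Set (c ⊔ˡ ℓ₂) where
    constructor _,⁺_
    field
      value    : Carrier
      positive : 0# <ᴷ value
  open K⁺ public

  infix  4 _≃_
  infixl 6 _+⁺_
  infixl 7 _*⁺_ _÷_
  infix  8 _⁻¹⁺

  _≃_ : Rel K⁺ ℓ₁
  u ≃ v = value u ≈ value v

  +-pos : ∀ {x y} → 0# <ᴷ x → 0# <ᴷ y → 0# <ᴷ x +ᴷ y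
  +-pos {x} {y} 0<x 0<y =
    <.trans 0<y (<.<-respˡ-≈ (+-identityˡ y) (+-monoˡ-< y 0<x))

  inverse : (u : K⁺) → Carrier
  inverse (x ,⁺ 0<x) with #⇒invertible (#-sym (<⇒# 0<x))
  ... | y , _ = y

  inverseˡ : ∀ u → inverse u *ᴷ value u ≈ 1#
  inverseˡ (x ,⁺ 0<x) with #⇒invertible (#-sym (<⇒# 0<x))
  ... | y , y*[x-0]≈1 , _ = trans (*-congˡ (sym (x-0≈x x))) y*[x-0]≈1

  inverse-pos : ∀ u → 0# <ᴷ inverse u
  inverse-pos u@(x ,⁺ 0<x) with #⇒<⊎> (invertibleˡ⇒# (x , x*[y-0]≈1))
    where
    x*[y-0]≈1 : x *ᴷ (inverse u - 0#) ≈ 1#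
    x*[y-0]≈1 = trans (*-congˡ (x-0≈x _)) (trans (*-comm x _) (inverseˡ u))
  ... | inj₂ 0<y = 0<y
  ... | inj₁ y<0 = ⊥-elim (<.asym 0<1 1<0)
    where
    y = inverse u
    0<-y : 0# <ᴷ - y
    0<-y = <.<-respˡ-≈ (-‿inverseʳ y) (<.<-respʳ-≈ (+-identityˡ (- y)) (+-monoˡ-< (- y) y<0))
    0<-1 : 0# <ᴷ - 1#
    0<-1 = <.<-respʳ-≈ (trans (sym (-‿distribˡ-* y x)) (-‿cong (inverseˡ u)))
             (*-pos 0<-y 0<x)
    1<0 : 1# <ᴷ 0#
    1<0 = <.<-respˡ-≈ (+-identityˡ 1#) (<.<-respʳ-≈ (-‿inverseˡ 1#) (+-monoˡ-< 1# 0<-1))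

  _+⁺_ _*⁺_ _÷_ : K⁺ → K⁺ → K⁺
  (x ,⁺ p) +⁺ (y ,⁺ q) = (x +ᴷ y) ,⁺ +-pos p q
  (x ,⁺ p) *⁺ (y ,⁺ q) = (x *ᴷ y) ,⁺ *-pos p q

  _⁻¹⁺ : K⁺ → K⁺
  u ⁻¹⁺ = inverse u ,⁺ inverse-pos u

  u ÷ v = u *⁺ v ⁻¹⁺

  suc-pos : ∀ n → 0# <ᴷ suc n ×ᴷ 1#
  suc-pos zero    = <.<-respʳ-≈ (sym (+-identityʳ 1#)) 0<1
  suc-pos (suc n) = +-pos 0<1 (suc-pos n)

  ι : (n : ℕ) → .{{_ : NonZero n}} → K⁺
  ι (suc n) = (suc n ×ᴷ 1#) ,⁺ suc-pos n

record IsCell (n r d : ℕ) : Set where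
  constructor isCell
  field
    1≤d : 1 ≤ d
    d≤r : d ≤ r
    r≤n : r ≤ n
open IsCell

data Side : Set where
  L R B : Side

module Grids {c ℓ₁ ℓ₂} (K : OrderedField c ℓ₁ ℓ₂) where
  open Positive K public

  Grid : ℕ → Set (c ⊔ˡ ℓ₂)
  Grid n = Side → (r d : ℕ) → .(IsCell n r d) → K⁺

  -- In the ratios of this module the truncated subtractions are exact: the lower bounds
  -- on the indices are arguments, and r - d, n - r are used only for
  -- d ≤ r ≤ n.

  r-RL : (r d : ℕ) → .(1 ≤ d) → K⁺
  r-RL r d 1≤d = ι (1 + 2 * (r ∸ d)) ÷ ι (2 * d ∸ 1) {{>-nonZero (m<n⇒0<n∸m (*-monoʳ-≤ 2 1≤d))}}

  r-BL : (n r d : ℕ) → .(1 ≤ d) → K⁺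
  r-BL n r d 1≤d = ι (1 + 2 * (n ∸ r)) ÷ ι (2 * d ∸ 1) {{>-nonZero (m<n⇒0<n∸m (*-monoʳ-≤ 2 1≤d))}}

  x-ratio : (n r : ℕ) → .(2 ≤ r) → K⁺
  x-ratio n r 2≤r =
    (ι (r ∸ 1) {{>-nonZero (m<n⇒0<n∸m 2≤r)}}
      ÷ ι (2 * r ∸ 1) {{>-nonZero (m<n⇒0<n∸m (*-monoʳ-≤ 2 (≤-trans (n≤1+n 1) 2≤r)))}})
    *⁺ (ι (3 + 2 * (n ∸ r)) ÷ ι (1 + (n ∸ r)))

  y-ratio : (r d : ℕ) → .(2 ≤ d) → K⁺
  y-ratio r d 2≤d =
    (ι (d ∸ 1) {{>-nonZero (m<n⇒0<n∸m 2≤d)}}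
      ÷ ι (2 * d ∸ 3) {{>-nonZero (m<n⇒0<n∸m (*-monoʳ-≤ 2 2≤d))}})
    *⁺ (ι (3 + 2 * (r ∸ d)) ÷ ι (1 + (r ∸ d)))

  left : ∀ {n r d} → 2 ≤ d → IsCell n r d → IsCell n r (d ∸ 1)
  left (s≤s 1≤d-1) p = isCell 1≤d-1 (≤-trans (n≤1+n _) (d≤r p)) (r≤n p)

  first : ∀ {n r} → 1 ≤ r → r ≤ n → IsCell n r 1
  first = isCell ℕ.≤-refl

  above : ∀ {n r} → 2 ≤ r → r ≤ n → IsCell n (r ∸ 1) 1
  above (s≤s 1≤r-1) r≤n = first 1≤r-1 (≤-trans (n≤1+n _) r≤n)

  record EdgeRatios (n : ℕ) (T : Grid n) : Set ℓ₁ where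
    field
      L-column : ∀ r (2≤r : 2 ≤ r) (r≤n : r ≤ n) →
        T L r 1 (first (≤-trans (n≤1+n 1) 2≤r) r≤n)
          ≃ x-ratio n r 2≤r *⁺ T L (r ∸ 1) 1 (above 2≤r r≤n)
      L-row : ∀ r d (2≤d : 2 ≤ d) (p : IsCell n r d) →
        T L r d p ≃ y-ratio r d 2≤d *⁺ T L r (d ∸ 1) (left 2≤d p)
      R-to-L : ∀ r d (p : IsCell n r d) →
        T R r d p ≃ r-RL r d (1≤d p) *⁺ T L r d p
      B-to-L : ∀ r d (p : IsCell n r d) →
        T B r d p ≃ r-BL n r d (1≤d p) *⁺ T L r d p

  initial-L : (n r d : ℕ) → .(IsCell n r d) → K⁺
  initial-L n r             zero          p = ⊥-elim-irr (ℕ.n≮0 (1≤d p))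
  initial-L n r             (suc (suc d)) p =
    y-ratio r (suc (suc d)) (s≤s (s≤s z≤n))
      *⁺ initial-L n r (suc d) (left (s≤s (s≤s z≤n)) p)
  initial-L n zero          (suc zero)    p = ⊥-elim-irr (ℕ.n≮0 (d≤r p))
  initial-L n (suc zero)    (suc zero)    p = ι 1
  initial-L n (suc (suc r)) (suc zero)    p =
    x-ratio n (suc (suc r)) (s≤s (s≤s z≤n))
      *⁺ initial-L n (suc r) 1 (above (s≤s (s≤s z≤n)) (r≤n p))

  initial : (m : ℕ) → Grid m
  initial m L r d p = initial-L m r d p
  initial m R r d p = r-RL r d (1≤d p) *⁺ initial-L m r d p
  initial m B r d p = r-BL m r d (1≤d p) *⁺ initial-L m r d p

  Δ Y : K⁺ → K⁺ → K⁺ → K⁺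
  Δ u v w = (u *⁺ v) ÷ (u +⁺ v +⁺ w)
  Y u v w = (u *⁺ v +⁺ v *⁺ w +⁺ w *⁺ u) ÷ u

  module Legs {n} (T : Grid n) where
    Y₁₂ Y₄ Y₈ : (r d : ℕ) → .(IsCell n r d) → K⁺
    Y₁₂ r d p = Δ (T L r d p) (T R r d p) (T B r d p)
    Y₄  r d p = Δ (T R r d p) (T B r d p) (T L r d p)
    Y₈  r d p = Δ (T B r d p) (T L r d p) (T R r d p)

  same : ∀ {n r d} → IsCell n r d → IsCell (suc n) r d
  same p = isCell (1≤d p) (d≤r p) (m≤n⇒m≤1+n (r≤n p))

  below : ∀ {n r d} → IsCell n r d → IsCell (suc n) (suc r) d
  below p = isCell (1≤d p) (m≤n⇒m≤1+n (d≤r p)) (s≤s (r≤n p))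

  diagonal : ∀ {n r d} → IsCell n r d → IsCell (suc n) (suc r) (suc d)
  diagonal p = isCell (m≤n⇒m≤1+n (1≤d p)) (s≤s (d≤r p)) (s≤s (r≤n p))

  right : ∀ {n r d} → d < r → IsCell n r d → IsCell n r (suc d)
  right d<r p = isCell (m≤n⇒m≤1+n (1≤d p)) d<r (r≤n p)

  diagonal₂ : ∀ {n r d} → r < n → IsCell n r d → IsCell (suc n) (suc (suc r)) (suc d)
  diagonal₂ r<n p = isCell (m≤n⇒m≤1+n (1≤d p)) (m≤n⇒m≤1+n (s≤s (d≤r p))) (s≤s r<n)

  module Reduction {n} (T : Grid (suc n)) where
    open Legs T

    reduce-L : (r d : ℕ) → .(IsCell n r d) → K⁺
    reduce-L r zero          p = ⊥-elim-irr (ℕ.n≮0 (1≤d p))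
    reduce-L r (suc zero)    p = Y₈ r 1 (same p) +⁺ Y₁₂ (suc r) 1 (below p)
    reduce-L r (suc (suc d)) p =
      Y (Y₄ r (suc d) (left (s≤s (s≤s z≤n)) (same p)))
        (Y₈ r (suc (suc d)) (same p))
        (Y₁₂ (suc r) (suc (suc d)) (below p))

    reduce-R : (r d : ℕ) → .(IsCell n r d) → K⁺
    reduce-R r d p with d ℕ.≟ r
    ... | yes _  = Y₄ r d (same p) +⁺ Y₁₂ (suc r) (suc d) (diagonal p)
    ... | no d≢r =
      Y (Y₈ r (suc d) (right (≤∧≢⇒< (d≤r p) d≢r) (same p)))
        (Y₄ r d (same p))
        (Y₁₂ (suc r) (suc d) (diagonal p))

    -- The child's bottom row is r = n, so suc r is then the parent's.
    reduce-B : (r d : ℕ) → .(IsCell n r d) → K⁺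
    reduce-B r d p with r ℕ.≟ n
    ... | yes _  = Y₄ (suc r) d (below p) +⁺ Y₈ (suc r) (suc d) (diagonal p)
    ... | no r≢n =
      Y (Y₁₂ (suc (suc r)) (suc d) (diagonal₂ (≤∧≢⇒< (r≤n p) r≢n) p))
        (Y₄ (suc r) d (below p))
        (Y₈ (suc r) (suc d) (diagonal p))

  rowReduce : ∀ {n} → Grid (suc n) → Grid n
  rowReduce T L = Reduction.reduce-L T
  rowReduce T R = Reduction.reduce-R T
  rowReduce T B = Reduction.reduce-B T

  -- The derivation of i ≤′ c has one ≤′-step per row reduction, c ∸ i in all.
  reduceTo : ∀ {i c} → i ≤′ c → Grid c → Grid i
  reduceTo (≤′-reflexive refl) T = T
  reduceTo (≤′-step i≤c)       T = reduceTo i≤c (rowReduce T)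

  reduced : (c i : ℕ) → i ≤ c → Grid i
  reduced c i i≤c = reduceTo (≤⇒≤′ i≤c) (initial c)

  t : (c i : ℕ) → 1 ≤ i → i ≤ c → K⁺
  t c i 1≤i i≤c = Legs.Y₁₂ (reduced c i i≤c) 1 1 (first ℕ.≤-refl 1≤i)

  f : (c i : ℕ) → .(1 ≤ i) → .(i < c) → K⁺
  f c i 1≤i i<c =
    ι 1 +⁺ (ι (c ∸ i) {{>-nonZero (m<n⇒0<n∸m i<c)}} ÷ ι i {{>-nonZero 1≤i}})
           *⁺ (ι 1 ÷ ι (1 + 2 * c))

{-# OPTIONS --safe #-}

-- Give the triangle T_{r,d} of an n-grid the coordinates a = r - d, b = d - 1, g = n - r, so
-- that a + b + g = n - 1, and put h(k) = ∏_{j=1}^{k} j/(2j+1).  The edge-ratio relationships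
-- say that, up to one factor for the whole grid, the labels L, R, B of the triangle are
-- (2b+1) P, (2a+1) P, (2g+1) P with P = h(a) h(b) h(g).  Since their sum is (2n+1) P, the legs
-- of the Δ-Y transform are products such as (2a+1)h(a) · (2b+1)h(b) · h(g) up to the factor
-- 1/(2n+1), and (2k+1) h(k) = k h(k-1) makes both the series and the Y-Δ combinations collapse
-- to the same shape with n replaced by n - 1 and an extra factor n/(2n+1) = h(n)/h(n-1).
-- Hence the labels of T^{c,i} are those of this shape times (c/(2c+1))/h(i).

module Submission where

open import Defs
open import Data.Nat.Base
  using (ℕ; zero; suc; _+_; _*_; _∸_; _≤_; _<_; s≤s; z≤n; NonZero; >-nonZero;
         _≤′_; ≤′-reflexive; ≤′-step)
open import Data.Nat.Properties using (≤-refl; <⇒≤)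
import Data.Nat.Properties as ℕ
open import Data.Nat.Tactic.RingSolver using () renaming (solve-∀ to ℕ-solve-∀)
open import Data.Product.Base using (_×_; _,_)
open import Relation.Nullary using (yes; no)
open import Relation.Binary.PropositionalEquality as ≡ using (_≡_; cong; cong₂)
open import Algebra.Bundles using (CommutativeRing)
import Algebra.Properties.Semiring.Mult as Mult
import Algebra.Solver.Ring.NaturalCoefficients.Default as SemiringSolver
import Relation.Binary.Reasoning.Setoid as SetoidReasoning

-- Division and numerals among the positive elements.

module SemifieldProperties {a ℓ₁ ℓ₂} (K : OrderedField a ℓ₁ ℓ₂) where
  open OrderedField K
  open Grids K
  private
    commutativeRing : CommutativeRing a ℓ₁
    commutativeRing = record { isCommutativeRing = isCommutativeRing }
  open CommutativeRing commutativeRing using (commutativeSemiring; semiring)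
  open Mult semiring using (×-homo-+; ×1-homo-*) renaming (_×_ to _×ᴷ_)
  open SemiringSolver commutativeSemiring public using (solve; _:=_; _:+_; _:*_)
  open SetoidReasoning setoid

  ≡⇒≃ : ∀ {u v} → u ≡ v → u ≃ v
  ≡⇒≃ ≡.refl = refl

  *⁺-cancelʳ : ∀ u v w → u *⁺ w ≃ v *⁺ w → u ≃ v
  *⁺-cancelʳ u v w uw≃vw = begin
    value u                              ≈⟨ expand u ⟩
    value u *ᴷ value w *ᴷ inverse w      ≈⟨ *-congʳ uw≃vw ⟩
    value v *ᴷ value w *ᴷ inverse w      ≈⟨ expand v ⟨
    value v                              ∎
    where
    expand : ∀ x → value x ≈ value x *ᴷ value w *ᴷ inverse w
    expand x = begin
      value x                              ≈⟨ *-identityʳ _ ⟨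
      value x *ᴷ 1#                        ≈⟨ *-congˡ (inverseˡ w) ⟨
      value x *ᴷ (inverse w *ᴷ value w)    ≈⟨ *-congˡ (*-comm _ _) ⟩
      value x *ᴷ (value w *ᴷ inverse w)    ≈⟨ *-assoc _ _ _ ⟨
      value x *ᴷ value w *ᴷ inverse w      ∎

  ÷-cancel : ∀ u v → (u ÷ v) *⁺ v ≃ u
  ÷-cancel u v = begin
    value u *ᴷ inverse v *ᴷ value v      ≈⟨ *-assoc _ _ _ ⟩
    value u *ᴷ (inverse v *ᴷ value v)    ≈⟨ *-congˡ (inverseˡ v) ⟩
    value u *ᴷ 1#                        ≈⟨ *-identityʳ _ ⟩
    value u                              ∎

  ÷-unique : ∀ u v w → u ≃ w *⁺ v → u ÷ v ≃ w
  ÷-unique u v w u≃wv = *⁺-cancelʳ (u ÷ v) w v (trans (÷-cancel u v) u≃wv)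

  ≃-÷ : ∀ u v w → w *⁺ v ≃ u → w ≃ u ÷ v
  ≃-÷ u v w wv≃u = sym (÷-unique u v w (sym wv≃u))

  ÷-inverse : ∀ u v → value (u ÷ v) *ᴷ value (v ÷ u) ≈ 1#
  ÷-inverse u v = begin
    value (u ÷ v) *ᴷ (value v *ᴷ inverse u)    ≈⟨ *-assoc _ _ _ ⟨
    value (u ÷ v) *ᴷ value v *ᴷ inverse u      ≈⟨ *-congʳ (÷-cancel u v) ⟩
    value u *ᴷ inverse u                       ≈⟨ *-comm _ _ ⟩
    inverse u *ᴷ value u                       ≈⟨ inverseˡ u ⟩
    1#                                         ∎

  -- The `NonZero` instances are irrelevant, so matching on the equation settles it whatever the
  -- instances are. The conclusion is propositional, so that `cong` can carry it under `÷` and `*⁺`.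
  ι-cong : ∀ {m n} .{{_ : NonZero m}} .{{_ : NonZero n}} → m ≡ n → ι m ≡ ι n
  ι-cong ≡.refl = ≡.refl

  -- `ι` computes only on a literal successor; this opens an abstract nonzero argument such as
  -- `m * n` to the homomorphism laws of `_×ᴷ_`.
  value-ι : ∀ n .{{_ : NonZero n}} → value (ι n) ≈ n ×ᴷ 1#
  value-ι (suc n) = refl

  ι-+ : ∀ m n .{{_ : NonZero m}} .{{_ : NonZero n}} .{{_ : NonZero (m + n)}} →
        ι m +⁺ ι n ≃ ι (m + n)
  ι-+ m n = begin
    value (ι m) +ᴷ value (ι n)    ≈⟨ +-cong (value-ι m) (value-ι n) ⟩
    m ×ᴷ 1# +ᴷ n ×ᴷ 1#            ≈⟨ ×-homo-+ 1# m n ⟨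
    (m + n) ×ᴷ 1#                 ≈⟨ value-ι (m + n) ⟨
    value (ι (m + n))             ∎

  ι-* : ∀ m n .{{_ : NonZero m}} .{{_ : NonZero n}} .{{_ : NonZero (m * n)}} →
        ι m *⁺ ι n ≃ ι (m * n)
  ι-* m n = begin
    value (ι m) *ᴷ value (ι n)    ≈⟨ *-cong (value-ι m) (value-ι n) ⟩
    (m ×ᴷ 1#) *ᴷ (n ×ᴷ 1#)        ≈⟨ ×1-homo-* m n ⟨
    (m * n) ×ᴷ 1#                 ≈⟨ value-ι (m * n) ⟨
    value (ι (m * n))             ∎

  ι1-identityˡ : ∀ u → ι 1 *⁺ u ≃ u
  ι1-identityˡ u = trans (*-congʳ (+-identityʳ 1#)) (*-identityˡ _)

  -- Closed forms of edges and legs.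

  odd : ℕ → K⁺
  odd k = ι (1 + 2 * k)

  -- In closed form this is k!/(2k+1)!!.
  h : ℕ → K⁺
  h zero    = ι 1
  h (suc k) = (ι (suc k) ÷ odd (suc k)) *⁺ h k

  oddh : ℕ → K⁺
  oddh k = odd k *⁺ h k

  oddh-zero : ∀ u → oddh 0 *⁺ u ≃ u
  oddh-zero u = trans (*-congʳ (ι1-identityˡ (ι 1))) (ι1-identityˡ u)

  oddh-suc : ∀ k → oddh (suc k) ≃ ι (suc k) *⁺ h k
  oddh-suc k = begin
    value (odd (suc k)) *ᴷ (value (ι (suc k) ÷ odd (suc k)) *ᴷ value (h k))
      ≈⟨ solve 3 (λ o q x → o :* (q :* x) := (q :* o) :* x) refl
           (value (odd (suc k))) (value (ι (suc k) ÷ odd (suc k))) (value (h k)) ⟩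
    value (ι (suc k) ÷ odd (suc k)) *ᴷ value (odd (suc k)) *ᴷ value (h k)
      ≈⟨ *-congʳ (÷-cancel (ι (suc k)) (odd (suc k))) ⟩
    value (ι (suc k)) *ᴷ value (h k) ∎

  -- The odd factor of an edge label sits on one coordinate. A leg comes from the product of two
  -- edges and so carries two odd factors; the third coordinate is the one without.
  edge leg : ℕ → ℕ → ℕ → K⁺
  edge x y z = oddh x *⁺ (h y *⁺ h z)
  leg  x y z = oddh x *⁺ oddh y *⁺ h z

  edge-comm : ∀ x y z → edge x y z ≃ edge x z y
  edge-comm x y z = *-congˡ (*-comm _ _)

  leg-comm : ∀ x y z → leg x y z ≃ leg y x z
  leg-comm x y z = *-congʳ (*-comm _ _)

  -- Both edges share `h x`, `h y` and `h z` and differ only in the coordinate that carries the odd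
  -- factor. This yields `r-RL` and `r-BL`.
  edge-ratio : ∀ x y z → edge x y z ≃ (odd x ÷ odd y) *⁺ edge y x z
  edge-ratio x y z = sym (begin
    value (odd x ÷ odd y) *ᴷ (value (odd y) *ᴷ value (h y) *ᴷ (value (h x) *ᴷ value (h z)))
      ≈⟨ solve 5 (λ q o a b c → q :* (o :* b :* (a :* c)) := (q :* o) :* a :* (b :* c)) refl
           (value (odd x ÷ odd y)) (value (odd y)) (value (h x)) (value (h y)) (value (h z)) ⟩
    value (odd x ÷ odd y) *ᴷ value (odd y) *ᴷ value (h x) *ᴷ (value (h y) *ᴷ value (h z))
      ≈⟨ *-congʳ (*-congʳ (÷-cancel (odd x) (odd y))) ⟩
    value (odd x) *ᴷ value (h x) *ᴷ (value (h y) *ᴷ value (h z)) ∎)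

  -- One unit moves from `z` to `y`, neither of which carries the odd factor, so the ratio is
  -- h(y+1)/h(y) times h(z)/h(z+1). Moving down the first column does this, whence `x-ratio`.
  edge-shift-base : ∀ x y z →
    edge x (suc y) z ≃ (ι (suc y) ÷ odd (suc y)) *⁺ (odd (suc z) ÷ ι (suc z)) *⁺ edge x y (suc z)
  edge-shift-base x y z = sym (begin
    p *ᴷ q *ᴷ (value (oddh x) *ᴷ (value (h y) *ᴷ (r *ᴷ value (h z))))
      ≈⟨ solve 6 (λ p q r o b c → p :* q :* (o :* (b :* (r :* c)))
                     := (q :* r) :* (o :* (p :* b :* c))) refl
           p q r (value (oddh x)) (value (h y)) (value (h z)) ⟩
    q *ᴷ r *ᴷ (value (oddh x) *ᴷ (p *ᴷ value (h y) *ᴷ value (h z)))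
      ≈⟨ *-congʳ (÷-inverse (odd (suc z)) (ι (suc z))) ⟩
    1# *ᴷ (value (oddh x) *ᴷ (p *ᴷ value (h y) *ᴷ value (h z)))
      ≈⟨ *-identityˡ _ ⟩
    value (oddh x) *ᴷ (p *ᴷ value (h y) *ᴷ value (h z)) ∎)
    where
    p q r : Carrier
    p = value (ι (suc y) ÷ odd (suc y))
    q = value (odd (suc z) ÷ ι (suc z))
    r = value (ι (suc z) ÷ odd (suc z))

  -- Here the unit moves from `y` into the coordinate with the odd factor. By `oddh-suc` that
  -- coordinate contributes (x+1)/(2x+1), and with x = d-2 this is where the 2d-3 of `y-ratio` comes
  -- from.
  edge-shift-apex : ∀ x y z →
    edge (suc x) y z ≃ (ι (suc x) ÷ odd x) *⁺ (odd (suc y) ÷ ι (suc y)) *⁺ edge x (suc y) z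
  edge-shift-apex x y z = sym (begin
    p *ᴷ q *ᴷ (value (odd x) *ᴷ value (h x) *ᴷ (r *ᴷ value (h y) *ᴷ value (h z)))
      ≈⟨ solve 7 (λ p q r o a b c → p :* q :* (o :* a :* (r :* b :* c))
                     := (q :* r) :* ((p :* o) :* a :* (b :* c))) refl
           p q r (value (odd x)) (value (h x)) (value (h y)) (value (h z)) ⟩
    q *ᴷ r *ᴷ (p *ᴷ value (odd x) *ᴷ value (h x) *ᴷ (value (h y) *ᴷ value (h z)))
      ≈⟨ *-congʳ (÷-inverse (odd (suc y)) (ι (suc y))) ⟩
    1# *ᴷ (p *ᴷ value (odd x) *ᴷ value (h x) *ᴷ (value (h y) *ᴷ value (h z)))
      ≈⟨ *-identityˡ _ ⟩
    p *ᴷ value (odd x) *ᴷ value (h x) *ᴷ (value (h y) *ᴷ value (h z))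
      ≈⟨ *-congʳ (*-congʳ (÷-cancel (ι (suc x)) (odd x))) ⟩
    value (ι (suc x)) *ᴷ value (h x) *ᴷ (value (h y) *ᴷ value (h z))
      ≈⟨ *-congʳ (oddh-suc x) ⟨
    value (oddh (suc x)) *ᴷ (value (h y) *ᴷ value (h z)) ∎)
    where
    p q r : Carrier
    p = value (ι (suc x) ÷ odd x)
    q = value (odd (suc y) ÷ ι (suc y))
    r = value (ι (suc y) ÷ odd (suc y))

  -- Δ-Y, series and Y-Δ steps on closed forms.

  odd-sum : ∀ {n} x y z → suc (x + y + z) ≡ n → odd x +⁺ odd y +⁺ odd z ≃ odd n
  odd-sum x y z ≡.refl = begin
    value (odd x) +ᴷ value (odd y) +ᴷ value (odd z)
      ≈⟨ +-congʳ (ι-+ (1 + 2 * x) (1 + 2 * y)) ⟩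
    value (ι (1 + 2 * x + (1 + 2 * y))) +ᴷ value (odd z)
      ≈⟨ ι-+ (1 + 2 * x + (1 + 2 * y)) (1 + 2 * z) ⟩
    value (ι (1 + 2 * x + (1 + 2 * y) + (1 + 2 * z)))
      ≈⟨ ≡⇒≃ (ι-cong (ℕ-identity x y z)) ⟩
    value (odd (suc (x + y + z))) ∎
    where
    ℕ-identity : ∀ x y z → 1 + 2 * x + (1 + 2 * y) + (1 + 2 * z) ≡ 1 + 2 * suc (x + y + z)
    ℕ-identity = ℕ-solve-∀

  -- The three edges share `s` and the product of the `h` factors, so by `odd-sum` the denominator
  -- is that product times `s` and 2n+1. Permuting the coordinates gives all three legs of a
  -- triangle.
  Δ-edge : ∀ s n x y z {u v w} → suc (x + y + z) ≡ n →
    u ≃ s *⁺ edge x y z → v ≃ s *⁺ edge y x z → w ≃ s *⁺ edge z x y →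
    Δ u v w ≃ (s ÷ odd n) *⁺ leg x y z
  Δ-edge s n x y z {u} {v} {w} eq u≃ v≃ w≃ =
    ÷-unique (u *⁺ v) (u +⁺ v +⁺ w) (q *⁺ leg x y z) (begin
      value u *ᴷ value v
        ≈⟨ *-cong u≃ v≃ ⟩
      value (s *⁺ edge x y z) *ᴷ value (s *⁺ edge y x z)
        -- Writing one `s` as `q` times the sum of the odd numbers lets the sum of the three edges
        -- be factored out, which leaves a division-free identity for the solver.
        ≈⟨ *-congʳ (*-congʳ s≃) ⟩
      value (q *⁺ (odd x +⁺ odd y +⁺ odd z) *⁺ edge x y z) *ᴷ value (s *⁺ edge y x z)
        ≈⟨ solve 8 (λ q s ox oy oz a b c →
             (q :* (ox :+ oy :+ oz) :* (ox :* a :* (b :* c))) :* (s :* (oy :* b :* (a :* c)))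
             := q :* (ox :* a :* (oy :* b) :* c) :*
                (s :* (ox :* a :* (b :* c)) :+ s :* (oy :* b :* (a :* c)) :+ s :* (oz :* c :* (a :* b)))) refl
             (value q) (value s) (value (odd x)) (value (odd y)) (value (odd z))
             (value (h x)) (value (h y)) (value (h z)) ⟩
      value (q *⁺ leg x y z) *ᴷ
        value (s *⁺ edge x y z +⁺ s *⁺ edge y x z +⁺ s *⁺ edge z x y)
        ≈⟨ *-congˡ (+-cong (+-cong u≃ v≃) w≃) ⟨
      value (q *⁺ leg x y z) *ᴷ value (u +⁺ v +⁺ w) ∎)
    where
    q : K⁺
    q = s ÷ odd n
    s≃ : s ≃ q *⁺ (odd x +⁺ odd y +⁺ odd z)
    s≃ = sym (trans (*-congˡ (odd-sum x y z eq)) (÷-cancel s (odd n)))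

  -- By `oddh-suc` the two legs become (y+1) and (x+1) times one common product, and these weights
  -- add up to n+1, the size of the parent grid.
  series : ∀ q n x y {u v} → suc (x + y) ≡ n →
    u ≃ q *⁺ leg 0 (suc y) x → v ≃ q *⁺ leg (suc x) 0 y →
    u +⁺ v ≃ q *⁺ ι (suc n) *⁺ edge 0 x y
  series q n x y {u} {v} eq u≃ v≃ = begin
    value u +ᴷ value v
      ≈⟨ +-cong u≃ v≃ ⟩
    value q *ᴷ (value (oddh 0) *ᴷ value (oddh (suc y)) *ᴷ value (h x)) +ᴷ
    value q *ᴷ (value (oddh (suc x)) *ᴷ value (oddh 0) *ᴷ value (h y))
      ≈⟨ +-cong (*-congˡ (*-congʳ (*-congˡ (oddh-suc y)))) (*-congˡ (*-congʳ (*-congʳ (oddh-suc x)))) ⟩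
    value q *ᴷ (value (oddh 0) *ᴷ value (ι (suc y) *⁺ h y) *ᴷ value (h x)) +ᴷ
    value q *ᴷ (value (ι (suc x) *⁺ h x) *ᴷ value (oddh 0) *ᴷ value (h y))
      ≈⟨ solve 6 (λ q o a b x y →
           q :* (o :* (y :* b) :* a) :+ q :* (x :* a :* o :* b) := q :* (x :+ y) :* (o :* (a :* b))) refl
           (value q) (value (oddh 0)) (value (h x)) (value (h y)) (value (ι (suc x))) (value (ι (suc y))) ⟩
    value (q *⁺ (ι (suc x) +⁺ ι (suc y)) *⁺ edge 0 x y)
      ≈⟨ *-congʳ (*-congˡ (ι-+ (suc x) (suc y))) ⟩
    value (q *⁺ ι (suc x + suc y) *⁺ edge 0 x y)
      ≈⟨ *-congʳ (*-congˡ (≡⇒≃ (ι-cong (cong suc (≡.trans (ℕ.+-suc x y) eq))))) ⟩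
    value (q *⁺ ι (suc n) *⁺ edge 0 x y) ∎

  -- With X = x+1, Y = y+1, Z = z+1, `oddh-suc` turns the legs into XY, ZY and XZ times a common
  -- factor p. The sum of their pairwise products is p²XYZ(X+Y+Z), and division by pXY leaves
  -- pZ(X+Y+Z), where X+Y+Z = n+1.
  Y-leg : ∀ q n x y z {u v w} → suc (suc z + x + y) ≡ n →
    u ≃ q *⁺ leg (suc x) (suc y) z →
    v ≃ q *⁺ leg (suc z) (suc y) x →
    w ≃ q *⁺ leg (suc x) (suc z) y →
    Y u v w ≃ q *⁺ ι (suc n) *⁺ edge (suc z) x y
  Y-leg q n x y z {u} {v} {w} eq u≃ v≃ w≃ = begin
    value (Y u v w)
      ≈⟨ ÷-unique (u *⁺ v +⁺ v *⁺ w +⁺ w *⁺ u) u (q *⁺ m *⁺ (Z *⁺ h z *⁺ (h x *⁺ h y))) (begin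
           value (u *⁺ v +⁺ v *⁺ w +⁺ w *⁺ u)
             ≈⟨ +-cong (+-cong (*-cong u≈ v≈) (*-cong v≈ w≈)) (*-cong w≈ u≈) ⟩
           value (u′ *⁺ v′ +⁺ v′ *⁺ w′ +⁺ w′ *⁺ u′)
             ≈⟨ solve 7 (λ q X Y Z a b c →
                  let u = q :* (X :* a :* (Y :* b) :* c)
                      v = q :* (Z :* c :* (Y :* b) :* a)
                      w = q :* (X :* a :* (Z :* c) :* b)
                  in u :* v :+ v :* w :+ w :* u
                     := q :* (X :+ Y :+ Z) :* (Z :* c :* (a :* b)) :* u) refl
                  (value q) (value X) (value Y′) (value Z)
                  (value (h x)) (value (h y)) (value (h z)) ⟩
           value (q *⁺ m *⁺ (Z *⁺ h z *⁺ (h x *⁺ h y)) *⁺ u′)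
             ≈⟨ *-congˡ u≈ ⟨
           value (q *⁺ m *⁺ (Z *⁺ h z *⁺ (h x *⁺ h y)) *⁺ u) ∎) ⟩
    value (q *⁺ m *⁺ (Z *⁺ h z *⁺ (h x *⁺ h y)))
      ≈⟨ *-cong (*-congˡ m≃) (*-congʳ (sym (oddh-suc z))) ⟩
    value (q *⁺ ι (suc n) *⁺ edge (suc z) x y) ∎
    where
    ℕ-identity : ∀ x y z → suc x + suc y + suc z ≡ suc (suc (suc z + x + y))
    ℕ-identity = ℕ-solve-∀
    X Y′ Z m u′ v′ w′ : K⁺
    X = ι (suc x)
    Y′ = ι (suc y)
    Z = ι (suc z)
    m = X +⁺ Y′ +⁺ Z
    u′ = q *⁺ (X *⁺ h x *⁺ (Y′ *⁺ h y) *⁺ h z)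
    v′ = q *⁺ (Z *⁺ h z *⁺ (Y′ *⁺ h y) *⁺ h x)
    w′ = q *⁺ (X *⁺ h x *⁺ (Z *⁺ h z) *⁺ h y)
    m≃ : m ≃ ι (suc n)
    m≃ = trans (trans (+-congʳ (ι-+ (suc x) (suc y))) (ι-+ (suc x + suc y) (suc z)))
               (≡⇒≃ (ι-cong (≡.trans (ℕ-identity x y z) (cong suc eq))))
    u≈ : u ≃ u′
    u≈ = trans u≃ (*-congˡ (*-congʳ (*-cong (oddh-suc x) (oddh-suc y))))
    v≈ : v ≃ v′
    v≈ = trans v≃ (*-congˡ (*-congʳ (*-cong (oddh-suc z) (oddh-suc y))))
    w≈ : w ≃ w′
    w≈ = trans w≃ (*-congˡ (*-congʳ (*-cong (oddh-suc x) (oddh-suc z))))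

-- Grids proportional to the closed form, and their legs.

module GridProperties {a ℓ₁ ℓ₂} (K : OrderedField a ℓ₁ ℓ₂) where
  open OrderedField K
  open Grids K
  open SemifieldProperties K
  open SetoidReasoning setoid

  closed : ℕ → Side → ℕ → ℕ → K⁺
  closed n L r d = edge (d ∸ 1) (r ∸ d) (n ∸ r)
  closed n R r d = edge (r ∸ d) (d ∸ 1) (n ∸ r)
  closed n B r d = edge (n ∸ r) (d ∸ 1) (r ∸ d)

  Proportional : ∀ {n} → K⁺ → Grid n → Set ℓ₁
  Proportional {n} s T = ∀ X r d (p : IsCell n r d) → T X r d p ≃ s *⁺ closed n X r d

  Proportional-resp-≃ : ∀ {n} {T : Grid n} s s′ → s ≃ s′ → Proportional s T → Proportional s′ T
  Proportional-resp-≃ s s′ s≃s′ T∝ X r d p = trans (T∝ X r d p) (*-congʳ s≃s′)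

  suc-∸ : ∀ {m n} → n ≤ m → suc m ∸ n ≡ suc (m ∸ n)
  suc-∸ n≤m = ℕ.+-∸-assoc 1 n≤m

  coordinate-sum : ∀ {n r d} {a b g} → IsCell n r d →
    r ∸ d ≡ a → d ∸ 1 ≡ b → n ∸ r ≡ g → suc (b + a + g) ≡ n
  coordinate-sum {n} {r} {suc b} (isCell _ d≤r r≤n) ≡.refl ≡.refl ≡.refl =
    ≡.trans (cong (_+ (n ∸ r)) (ℕ.m+[n∸m]≡n d≤r)) (ℕ.m+[n∸m]≡n r≤n)

  module _ {n} (s : K⁺) (T : Grid n) (T∝ : Proportional s T) where
    open Legs T

    -- The coordinates enter through equations, here and in the next two lemmas, so that a caller
    -- can present them as 0 or as a successor, the shapes that `series` and `Y-leg` match.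
    Y₁₂-leg : ∀ r d {a b g} (p : IsCell n r d) → r ∸ d ≡ a → d ∸ 1 ≡ b → n ∸ r ≡ g →
      Y₁₂ r d p ≃ (s ÷ odd n) *⁺ leg b a g
    Y₁₂-leg r d {a} {b} {g} p ≡.refl ≡.refl ≡.refl =
      -- `≃` sees only values and cannot determine the positivity components, so the labels are
      -- given explicitly.
      Δ-edge s n b a g {T L r d p} {T R r d p} {T B r d p}
        (coordinate-sum p ≡.refl ≡.refl ≡.refl)
        (T∝ L r d p) (T∝ R r d p) (T∝ B r d p)

    Y₄-leg : ∀ r d {a b g} (p : IsCell n r d) → r ∸ d ≡ a → d ∸ 1 ≡ b → n ∸ r ≡ g →
      Y₄ r d p ≃ (s ÷ odd n) *⁺ leg a g b
    Y₄-leg r d {a} {b} {g} p ≡.refl ≡.refl ≡.refl =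
      Δ-edge s n a g b {T R r d p} {T B r d p} {T L r d p}
        (≡.trans (ℕ-identity a g b) (coordinate-sum p ≡.refl ≡.refl ≡.refl))
        (trans (T∝ R r d p) (*-congˡ (edge-comm a b g)))
        (trans (T∝ B r d p) (*-congˡ (edge-comm g b a)))
        (T∝ L r d p)
      where
      ℕ-identity : ∀ a g b → suc (a + g + b) ≡ suc (b + a + g)
      ℕ-identity = ℕ-solve-∀

    Y₈-leg : ∀ r d {a b g} (p : IsCell n r d) → r ∸ d ≡ a → d ∸ 1 ≡ b → n ∸ r ≡ g →
      Y₈ r d p ≃ (s ÷ odd n) *⁺ leg g b a
    Y₈-leg r d {a} {b} {g} p ≡.refl ≡.refl ≡.refl =
      Δ-edge s n g b a {T B r d p} {T L r d p} {T R r d p}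
        (≡.trans (ℕ-identity g b a) (coordinate-sum p ≡.refl ≡.refl ≡.refl))
        (T∝ B r d p)
        (trans (T∝ L r d p) (*-congˡ (edge-comm b a g)))
        (trans (T∝ R r d p) (*-congˡ (edge-comm a b g)))
      where
      ℕ-identity : ∀ g b a → suc (g + b + a) ≡ suc (b + a + g)
      ℕ-identity = ℕ-solve-∀

  -- Row reduction, once and repeatedly.

  module _ {n} (s : K⁺) (T : Grid (suc n)) (T∝ : Proportional s T) where
    open Legs T
    private
      q : K⁺
      q = s ÷ odd (suc n)

    -- For a child triangle with coordinates (a, b, g), the parent triangles at `below`, `diagonal`
    -- and `same` raise a, b and g respectively. The edges L, R, B belong to b, a, g, and each uses
    -- the two triangles that raise the other coordinates. If its own coordinate is 0, the edge is
    -- on the boundary and the two legs are in series; otherwise a third leg comes from the parent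
    -- triangle that lowers its own coordinate and raises the other two.
    rowReduce-proportional : Proportional (q *⁺ ι (suc n)) (rowReduce T)
    rowReduce-proportional L r (suc zero) p@(isCell 1≤d d≤r r≤n) =
      series q n (r ∸ 1) (n ∸ r) {Y₈ r 1 (same p)} {Y₁₂ (suc r) 1 (below p)}
        (coordinate-sum p ≡.refl ≡.refl ≡.refl)
        (trans (Y₈-leg s T T∝ r 1 (same p) ≡.refl ≡.refl (suc-∸ r≤n))
               (*-congˡ (leg-comm (suc (n ∸ r)) 0 (r ∸ 1))))
        (trans (Y₁₂-leg s T T∝ (suc r) 1 (below p) (suc-∸ d≤r) ≡.refl ≡.refl)
               (*-congˡ (leg-comm 0 (suc (r ∸ 1)) (n ∸ r))))
    rowReduce-proportional L r d@(suc (suc z)) p@(isCell 1≤d d≤r r≤n) =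
      Y-leg q n x y z {Y₄ r (suc z) p′} {Y₈ r d (same p)} {Y₁₂ (suc r) d (below p)}
        (coordinate-sum p ≡.refl ≡.refl ≡.refl)
        (Y₄-leg s T T∝ r (suc z) p′ (suc-∸ d≤r) ≡.refl (suc-∸ r≤n))
        (trans (Y₈-leg s T T∝ r d (same p) ≡.refl ≡.refl (suc-∸ r≤n))
               (*-congˡ (leg-comm (suc y) (suc z) x)))
        (trans (Y₁₂-leg s T T∝ (suc r) d (below p) (suc-∸ d≤r) ≡.refl ≡.refl)
               (*-congˡ (leg-comm (suc z) (suc x) y)))
      where
      x y : ℕ
      x = r ∸ d
      y = n ∸ r
      p′ : IsCell (suc n) r (suc z)
      p′ = left (s≤s (s≤s z≤n)) (same p)
    rowReduce-proportional R r d@(suc x) p@(isCell 1≤d d≤r r≤n) with d ℕ.≟ r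
    ... | yes ≡.refl =
      trans (series q n x y {Y₄ r d (same p)} {Y₁₂ (suc r) (suc d) (diagonal p)}
              (≡.trans (cong (λ k → suc (k + y)) (≡.sym (ℕ.+-identityʳ x)))
                       (coordinate-sum p (ℕ.n∸n≡0 r) ≡.refl ≡.refl))
              (Y₄-leg s T T∝ r d (same p) (ℕ.n∸n≡0 r) ≡.refl (suc-∸ r≤n))
              (Y₁₂-leg s T T∝ (suc r) (suc d) (diagonal p) (ℕ.n∸n≡0 r) ≡.refl ≡.refl))
            -- The label in `closed` has r ∸ r as its first coordinate, which does not reduce to 0.
            (*-congˡ (≡⇒≃ (cong (λ k → edge k x y) (≡.sym (ℕ.n∸n≡0 r)))))
      where
      y : ℕ
      y = n ∸ r
    ... | no d≢r =
      trans (Y-leg q n x y z {Y₈ r (suc d) p′} {Y₄ r d (same p)} {Y₁₂ (suc r) (suc d) (diagonal p)}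
              (≡.trans (ℕ-identity x y z) (coordinate-sum p r∸d ≡.refl ≡.refl))
              (trans (Y₈-leg s T T∝ r (suc d) p′ ≡.refl ≡.refl (suc-∸ r≤n))
                     (*-congˡ (leg-comm (suc y) (suc x) z)))
              (Y₄-leg s T T∝ r d (same p) r∸d ≡.refl (suc-∸ r≤n))
              (Y₁₂-leg s T T∝ (suc r) (suc d) (diagonal p) r∸d ≡.refl ≡.refl))
            (*-congˡ (≡⇒≃ (cong (λ k → edge k x y) (≡.sym r∸d))))
      where
      d<r : d < r
      d<r = ℕ.≤∧≢⇒< d≤r d≢r
      p′ : IsCell (suc n) r (suc d)
      p′ = right d<r (same p)
      y z : ℕ
      y = n ∸ r
      z = r ∸ suc d
      r∸d : r ∸ d ≡ suc z
      r∸d = suc-∸ d<r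
      ℕ-identity : ∀ x y z → suc (suc z + x + y) ≡ suc (x + suc z + y)
      ℕ-identity = ℕ-solve-∀
    rowReduce-proportional B r d@(suc x) p@(isCell 1≤d d≤r r≤n) with r ℕ.≟ n
    ... | yes ≡.refl =
      trans (series q n x y {Y₄ (suc r) d (below p)} {Y₈ (suc r) (suc d) (diagonal p)}
              (≡.trans (≡.sym (ℕ.+-identityʳ (suc (x + y))))
                       (coordinate-sum p ≡.refl ≡.refl (ℕ.n∸n≡0 r)))
              (trans (Y₄-leg s T T∝ (suc r) d (below p) (suc-∸ d≤r) ≡.refl (ℕ.n∸n≡0 r))
                     (*-congˡ (leg-comm (suc y) 0 x)))
              (trans (Y₈-leg s T T∝ (suc r) (suc d) (diagonal p) ≡.refl ≡.refl (ℕ.n∸n≡0 r))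
                     (*-congˡ (leg-comm 0 (suc x) y))))
            (*-congˡ (≡⇒≃ (cong (λ k → edge k x y) (≡.sym (ℕ.n∸n≡0 r)))))
      where
      y : ℕ
      y = r ∸ d
    ... | no r≢n =
      trans (Y-leg q n x y z {Y₁₂ (suc (suc r)) (suc d) p′} {Y₄ (suc r) d (below p)}
                   {Y₈ (suc r) (suc d) (diagonal p)}
              (≡.trans (ℕ-identity x y z) (coordinate-sum p ≡.refl ≡.refl n∸r))
              (Y₁₂-leg s T T∝ (suc (suc r)) (suc d) p′ (suc-∸ d≤r) ≡.refl ≡.refl)
              (trans (Y₄-leg s T T∝ (suc r) d (below p) (suc-∸ d≤r) ≡.refl n∸r)
                     (*-congˡ (leg-comm (suc y) (suc z) x)))
              (trans (Y₈-leg s T T∝ (suc r) (suc d) (diagonal p) ≡.refl ≡.refl n∸r)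
                     (*-congˡ (leg-comm (suc z) (suc x) y))))
            (*-congˡ (≡⇒≃ (cong (λ k → edge k x y) (≡.sym n∸r))))
      where
      r<n : r < n
      r<n = ℕ.≤∧≢⇒< r≤n r≢n
      p′ : IsCell (suc n) (suc (suc r)) (suc d)
      p′ = diagonal₂ r<n p
      y z : ℕ
      y = r ∸ d
      z = n ∸ suc r
      n∸r : n ∸ r ≡ suc z
      n∸r = suc-∸ r<n
      ℕ-identity : ∀ x y z → suc (suc z + x + y) ≡ suc (x + y + suc z)
      ℕ-identity = ℕ-solve-∀

  -- A reduction from size n+1 to n multiplies the factor by (n+1)/(2n+3) = h(n+1)/h(n), so the
  -- factor times `h` of the size is an invariant, `k`.
  reduceTo-proportional : ∀ {i c} (k : K⁺) (i≤c : i ≤′ c) (T : Grid c) →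
    Proportional (k ÷ h c) T → Proportional (k ÷ h i) (reduceTo i≤c T)
  reduceTo-proportional k (≤′-reflexive ≡.refl) T T∝ = T∝
  reduceTo-proportional k (≤′-step {n} i≤n) T T∝ =
    reduceTo-proportional k i≤n (rowReduce T)
      (Proportional-resp-≃ {T = rowReduce T} s (k ÷ h n) s≃k÷h
        (rowReduce-proportional (k ÷ h (suc n)) T T∝))
    where
    s : K⁺
    s = (k ÷ h (suc n)) ÷ odd (suc n) *⁺ ι (suc n)
    s≃k÷h : s ≃ k ÷ h n
    s≃k÷h = ≃-÷ k (h n) s (begin
      value s *ᴷ value (h n)
        ≈⟨ solve 4 (λ q o⁻¹ m x → q :* o⁻¹ :* m :* x := q :* (m :* o⁻¹ :* x)) refl
             (value (k ÷ h (suc n))) (inverse (odd (suc n))) (value (ι (suc n))) (value (h n)) ⟩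
      -- The regrouped product is `h (suc n)` by definition.
      value (k ÷ h (suc n)) *ᴷ value (h (suc n))
        ≈⟨ ÷-cancel k (h (suc n)) ⟩
      value k ∎)

  -- Edge-ratio relationships and the initial grid.

  closed-L-column : ∀ n r (2≤r : 2 ≤ r) → r ≤ n →
    closed n L r 1 ≃ x-ratio n r 2≤r *⁺ closed n L (r ∸ 1) 1
  closed-L-column n (suc (suc y)) (s≤s (s≤s _)) r≤n =
    trans (edge-shift-base 0 y g)
      (≡⇒≃ (cong₂ _*⁺_
        (cong₂ _*⁺_
          (cong (ι (suc y) ÷_) (ι-cong (≡.sym (cong (_∸ 1) (ℕ.*-suc 2 (suc y))))))
          (cong (_÷ ι (suc g)) (ι-cong (cong suc (ℕ.*-suc 2 g)))))
        (cong (edge 0 y) (≡.sym (suc-∸ r≤n)))))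
    where
    g : ℕ
    g = n ∸ suc (suc y)

  closed-L-row : ∀ n r d (2≤d : 2 ≤ d) → d ≤ r →
    closed n L r d ≃ y-ratio r d 2≤d *⁺ closed n L r (d ∸ 1)
  closed-L-row n r (suc (suc x)) 2≤d@(s≤s (s≤s _)) d≤r =
    trans (edge-shift-apex x y g)
      (≡⇒≃ (cong₂ _*⁺_
        (cong₂ _*⁺_
          (cong (ι (suc x) ÷_)
            -- With d = x+2, 2d ∸ 3 does not reduce to a successor, so its `NonZero` instance is
            -- passed by hand.
            (ι-cong {{_}} {{>-nonZero (ℕ.m<n⇒0<n∸m (ℕ.*-monoʳ-≤ 2 2≤d))}}
              (≡.sym (cong (_∸ 3) (≡.trans (ℕ.*-suc 2 (suc x)) (cong (2 +_) (ℕ.*-suc 2 x)))))))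
          (cong (_÷ ι (suc y)) (ι-cong (cong suc (ℕ.*-suc 2 y)))))
        (cong (λ k → edge x k g) (≡.sym (suc-∸ d≤r)))))
    where
    y g : ℕ
    y = r ∸ suc (suc x)
    g = n ∸ r

  odd-pred : ∀ b →
    odd b ≡ ι (2 * suc b ∸ 1) {{>-nonZero (ℕ.m<n⇒0<n∸m (ℕ.*-monoʳ-≤ 2 (s≤s (z≤n {b}))))}}
  odd-pred b = ι-cong {{_}} {{>-nonZero (ℕ.m<n⇒0<n∸m (ℕ.*-monoʳ-≤ 2 (s≤s (z≤n {b}))))}}
    (≡.sym (cong (_∸ 1) (ℕ.*-suc 2 b)))

  closed-R-to-L : ∀ n r d .(1≤d : 1 ≤ d) → closed n R r d ≃ r-RL r d 1≤d *⁺ closed n L r d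
  closed-R-to-L n r (suc b) 1≤d =
    trans (edge-ratio (r ∸ suc b) b (n ∸ r))
      (*-congʳ (≡⇒≃ (cong (odd (r ∸ suc b) ÷_) (odd-pred b))))

  closed-B-to-L : ∀ n r d .(1≤d : 1 ≤ d) → closed n B r d ≃ r-BL n r d 1≤d *⁺ closed n L r d
  closed-B-to-L n r (suc b) 1≤d =
    trans (edge-ratio (n ∸ r) b (r ∸ suc b))
      (*-cong (≡⇒≃ (cong (odd (n ∸ r) ÷_) (odd-pred b)))
              (edge-comm b (n ∸ r) (r ∸ suc b)))

  -- Transfers a ratio between closed forms to labels proportional to them. It serves in both
  -- directions: to derive the edge ratios, and, reversed, to identify a grid that is built from
  -- them.
  scaled-ratio : ∀ {s ρ x y v} → v ≈ s *ᴷ y → x ≈ ρ *ᴷ y → s *ᴷ x ≈ ρ *ᴷ v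
  scaled-ratio {s} {ρ} {x} {y} {v} v≈ x≈ = begin
    s *ᴷ x             ≈⟨ *-congˡ x≈ ⟩
    s *ᴷ (ρ *ᴷ y)      ≈⟨ solve 3 (λ s ρ y → s :* (ρ :* y) := ρ :* (s :* y)) refl s ρ y ⟩
    ρ *ᴷ (s *ᴷ y)      ≈⟨ *-congˡ v≈ ⟨
    ρ *ᴷ v             ∎

  proportional⇒edgeRatios : ∀ {n} s (T : Grid n) → Proportional s T → EdgeRatios n T
  proportional⇒edgeRatios {n} s T T∝ = record
    { L-column = λ r 2≤r r≤n →
        trans (T∝ L r 1 (first (<⇒≤ 2≤r) r≤n))
          (scaled-ratio (T∝ L (r ∸ 1) 1 (above 2≤r r≤n)) (closed-L-column n r 2≤r r≤n))
    ; L-row = λ r d 2≤d p →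
        trans (T∝ L r d p)
          (scaled-ratio (T∝ L r (d ∸ 1) (left 2≤d p)) (closed-L-row n r d 2≤d (IsCell.d≤r p)))
    ; R-to-L = λ r d p →
        trans (T∝ R r d p) (scaled-ratio (T∝ L r d p) (closed-R-to-L n r d (IsCell.1≤d p)))
    ; B-to-L = λ r d p →
        trans (T∝ B r d p) (scaled-ratio (T∝ L r d p) (closed-B-to-L n r d (IsCell.1≤d p)))
    }

  -- Induction along the recursion of `initial-L`. The factor is fixed at the top triangle, where
  -- the label is 1 and the closed form is h(n-1).
  initial-L-closed : ∀ n r d (p : IsCell n r d) →
    initial-L n r d p ≃ (ι 1 ÷ h (n ∸ 1)) *⁺ closed n L r d
  initial-L-closed n r (suc (suc b)) p =
    sym (scaled-ratio (initial-L-closed n r (suc b) (left 2≤d p))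
                      (closed-L-row n r (suc (suc b)) 2≤d (IsCell.d≤r p)))
    where
    2≤d : 2 ≤ suc (suc b)
    2≤d = s≤s (s≤s z≤n)
  initial-L-closed n zero          (suc zero) (isCell _ () _)
  initial-L-closed n (suc zero)    (suc zero) p = sym (begin
    value (ι 1 ÷ h (n ∸ 1)) *ᴷ (value (oddh 0) *ᴷ (value (ι 1) *ᴷ value (h (n ∸ 1))))
      ≈⟨ *-congˡ (trans (oddh-zero (ι 1 *⁺ h (n ∸ 1))) (ι1-identityˡ (h (n ∸ 1)))) ⟩
    value (ι 1 ÷ h (n ∸ 1)) *ᴷ value (h (n ∸ 1))
      ≈⟨ ÷-cancel (ι 1) (h (n ∸ 1)) ⟩
    value (ι 1) ∎)
  initial-L-closed n (suc (suc y)) (suc zero) p =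
    sym (scaled-ratio (initial-L-closed n (suc y) 1 (above 2≤r (IsCell.r≤n p)))
                      (closed-L-column n (suc (suc y)) 2≤r (IsCell.r≤n p)))
    where
    2≤r : 2 ≤ suc (suc y)
    2≤r = s≤s (s≤s z≤n)

  initial-proportional : ∀ n → Proportional (ι 1 ÷ h (n ∸ 1)) (initial n)
  initial-proportional n L r d p = initial-L-closed n r d p
  initial-proportional n R r d p =
    sym (scaled-ratio (initial-L-closed n r d p) (closed-R-to-L n r d (IsCell.1≤d p)))
  initial-proportional n B r d p =
    sym (scaled-ratio (initial-L-closed n r d p) (closed-B-to-L n r d (IsCell.1≤d p)))

  -- Scale factors of the reductions: tails and `f`.

  module _ (m : ℕ) where
    private
      c : ℕ
      c = suc m
      k : K⁺
      k = ι c ÷ odd c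

    -- Since h(c) = k h(c-1), the initial factor 1/h(c-1) equals k/h(c), which starts the invariant
    -- of `reduceTo-proportional`.
    reduced-proportional : ∀ i (i≤c : i ≤ c) → Proportional (k ÷ h i) (reduced c i i≤c)
    reduced-proportional i i≤c =
      reduceTo-proportional k (ℕ.≤⇒≤′ i≤c) (initial c)
        (Proportional-resp-≃ {T = initial c} (ι 1 ÷ h m) (k ÷ h c) scale (initial-proportional c))
      where
      scale : ι 1 ÷ h m ≃ k ÷ h c
      scale = ≃-÷ k (h c) (ι 1 ÷ h m) (begin
        value (ι 1 ÷ h m) *ᴷ (value k *ᴷ value (h m))
          ≈⟨ solve 3 (λ q k x → q :* (k :* x) := (q :* x) :* k) refl
               (value (ι 1 ÷ h m)) (value k) (value (h m)) ⟩
        value (ι 1 ÷ h m) *ᴷ value (h m) *ᴷ value k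
          ≈⟨ *-congʳ (÷-cancel (ι 1) (h m)) ⟩
        value (ι 1) *ᴷ value k
          ≈⟨ ι1-identityˡ k ⟩
        value k ∎)

    -- The top triangle has coordinates (0, 0, i-1), so its leg is h(i-1) times k/(h(i)(2i+1)), and
    -- h(i)(2i+1) = i h(i-1).
    tail : ∀ j (i≤c : suc j ≤ c) → t c (suc j) (s≤s z≤n) i≤c ≃ k ÷ ι (suc j)
    tail j i≤c = ≃-÷ k (ι i) (t c i (s≤s z≤n) i≤c) (begin
      value (t c i (s≤s z≤n) i≤c) *ᴷ value (ι i)
        ≈⟨ *-congʳ (Y₁₂-leg (k ÷ h i) (reduced c i i≤c) (reduced-proportional i i≤c) 1 1
             (first ≤-refl (s≤s z≤n)) ≡.refl ≡.refl ≡.refl) ⟩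
      value (k ÷ h i ÷ odd i) *ᴷ value (leg 0 0 j) *ᴷ value (ι i)
        ≈⟨ *-congʳ (*-congˡ (trans (*-congʳ (oddh-zero (oddh 0))) (oddh-zero (h j)))) ⟩
      value (k ÷ h i ÷ odd i) *ᴷ value (h j) *ᴷ value (ι i)
        ≈⟨ solve 4 (λ q o⁻¹ x m → q :* o⁻¹ :* x :* m := q :* (m :* o⁻¹ :* x)) refl
             (value (k ÷ h i)) (inverse (odd i)) (value (h j)) (value (ι i)) ⟩
      value (k ÷ h i) *ᴷ value (h i)
        ≈⟨ ÷-cancel k (h i) ⟩
      value k ∎)
      where
      i : ℕ
      i = suc j

    tail-1 : (1≤c : 1 ≤ c) → t c 1 ≤-refl 1≤c ≃ k
    tail-1 1≤c = trans (tail 0 1≤c) (÷-unique k (ι 1) k (sym (trans (*-comm _ _) (ι1-identityˡ k))))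

    tail-ratio : ∀ i (1≤i : 1 ≤ i) (i≤c : i ≤ c) (1≤c : 1 ≤ c) →
      t c i 1≤i i≤c ≃ (ι 1 ÷ ι i {{>-nonZero 1≤i}}) *⁺ t c 1 ≤-refl 1≤c
    tail-ratio (suc j) (s≤s z≤n) i≤c 1≤c = begin
      value (t c i (s≤s z≤n) i≤c)                       ≈⟨ tail j i≤c ⟩
      value k *ᴷ inverse (ι i)                          ≈⟨ *-comm _ _ ⟩
      inverse (ι i) *ᴷ value k                          ≈⟨ *-congʳ (ι1-identityˡ (ι i ⁻¹⁺)) ⟨
      value (ι 1 ÷ ι i) *ᴷ value k                      ≈⟨ *-congˡ (tail-1 1≤c) ⟨
      value (ι 1 ÷ ι i) *ᴷ value (t c 1 ≤-refl 1≤c)     ∎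
      where
      i : ℕ
      i = suc j

    -- The factors of the reduced and the initial i-grid are k/h(i) and 1/h(i-1), with quotient
    -- k(2i+1)/i. That this is `f` comes down to i(2c+1) + (c-i) = c(2i+1).
    f-scale : ∀ j (i<c : suc j < c) →
      f c (suc j) (s≤s z≤n) i<c *⁺ (ι (suc j) ÷ odd (suc j)) ≃ k
    f-scale j i<c = ≃-÷ (ι c) (odd c) F (*⁺-cancelʳ (F *⁺ odd c) (ι c) (odd i) (begin
      φ *ᴷ value (ι i ÷ odd i) *ᴷ value (odd c) *ᴷ value (odd i)
        ≈⟨ solve 4 (λ φ q C o → φ :* q :* C :* o := φ :* (q :* o) :* C) refl
             φ (value (ι i ÷ odd i)) (value (odd c)) (value (odd i)) ⟩
      φ *ᴷ (value (ι i ÷ odd i) *ᴷ value (odd i)) *ᴷ value (odd c)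
        ≈⟨ *-congʳ (*-congˡ (÷-cancel (ι i) (odd i))) ⟩
      -- With `f` unfolded, the remaining factors i and 2c+1 are exactly its two denominators.
      (value (ι 1) +ᴷ value (δ ÷ ι i) *ᴷ value (ι 1 ÷ odd c)) *ᴷ value (ι i) *ᴷ value (odd c)
        ≈⟨ solve 5 (λ e q w m C → (e :+ q :* w) :* m :* C := e :* (m :* C) :+ (q :* m) :* (w :* C)) refl
             (value (ι 1)) (value (δ ÷ ι i)) (value (ι 1 ÷ odd c)) (value (ι i)) (value (odd c)) ⟩
      value (ι 1) *ᴷ (value (ι i) *ᴷ value (odd c)) +ᴷ
      value (δ ÷ ι i) *ᴷ value (ι i) *ᴷ (value (ι 1 ÷ odd c) *ᴷ value (odd c))
        ≈⟨ +-cong (ι1-identityˡ (ι i *⁺ odd c)) (*-cong (÷-cancel δ (ι i)) (÷-cancel (ι 1) (odd c))) ⟩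
      value (ι i) *ᴷ value (odd c) +ᴷ value δ *ᴷ value (ι 1)
        ≈⟨ +-cong (ι-* i (1 + 2 * c)) (trans (*-comm _ _) (ι1-identityˡ δ)) ⟩
      value (ι (i * (1 + 2 * c))) +ᴷ value δ
        ≈⟨ ι-+ (i * (1 + 2 * c)) (c ∸ i) {{_}} {{δ≢0}} ⟩
      value (ι (i * (1 + 2 * c) + (c ∸ i)))
        ≈⟨ ≡⇒≃ (ι-cong ℕ-identity) ⟩
      value (ι (c * (1 + 2 * i)))
        ≈⟨ ι-* c (1 + 2 * i) ⟨
      value (ι c) *ᴷ value (odd i) ∎))
      where
      i : ℕ
      i = suc j
      δ≢0 : NonZero (c ∸ i)
      δ≢0 = >-nonZero (ℕ.m<n⇒0<n∸m i<c)
      δ F : K⁺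
      δ = ι (c ∸ i) {{δ≢0}}
      F = f c i (s≤s z≤n) i<c *⁺ (ι i ÷ odd i)
      φ : Carrier
      φ = value (f c i (s≤s z≤n) i<c)
      -- Setting c = i + δ removes the truncated subtraction before the ring solver is called.
      expand : ∀ i δ → i * (1 + 2 * (i + δ)) + δ ≡ (i + δ) * (1 + 2 * i)
      expand = ℕ-solve-∀
      ℕ-identity : i * (1 + 2 * c) + (c ∸ i) ≡ c * (1 + 2 * i)
      ℕ-identity = ≡.subst (λ n → i * (1 + 2 * n) + (c ∸ i) ≡ n * (1 + 2 * i))
        (ℕ.m+[n∸m]≡n (<⇒≤ i<c)) (expand i (c ∸ i))

    reduced-initial : ∀ i (1≤i : 1 ≤ i) (i<c : i < c) X r d (p : IsCell i r d) →
      reduced c i (<⇒≤ i<c) X r d p ≃ f c i 1≤i i<c *⁺ initial i X r d p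
    reduced-initial (suc j) 1≤i i<c X r d p = begin
      value (reduced c i (<⇒≤ i<c) X r d p)
        ≈⟨ reduced-proportional i (<⇒≤ i<c) X r d p ⟩
      value (k ÷ h i) *ᴷ value (closed i X r d)
        ≈⟨ *-congʳ scale ⟨
      φ *ᴷ value (ι 1 ÷ h j) *ᴷ value (closed i X r d)
        ≈⟨ *-assoc _ _ _ ⟩
      φ *ᴷ (value (ι 1 ÷ h j) *ᴷ value (closed i X r d))
        ≈⟨ *-congˡ (initial-proportional i X r d p) ⟨
      φ *ᴷ value (initial i X r d p) ∎
      where
      i : ℕ
      i = suc j
      φ : Carrier
      φ = value (f c i 1≤i i<c)
      scale : f c i 1≤i i<c *⁺ (ι 1 ÷ h j) ≃ k ÷ h i
      scale = ≃-÷ k (h i) (f c i 1≤i i<c *⁺ (ι 1 ÷ h j)) (begin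
        φ *ᴷ value (ι 1 ÷ h j) *ᴷ (value (ι i ÷ odd i) *ᴷ value (h j))
          ≈⟨ solve 4 (λ φ w q x → φ :* w :* (q :* x) := (w :* x) :* (φ :* q)) refl
               φ (value (ι 1 ÷ h j)) (value (ι i ÷ odd i)) (value (h j)) ⟩
        value (ι 1 ÷ h j) *ᴷ value (h j) *ᴷ (φ *ᴷ value (ι i ÷ odd i))
          ≈⟨ *-cong (÷-cancel (ι 1) (h j)) (f-scale j i<c) ⟩
        value (ι 1) *ᴷ value k
          ≈⟨ ι1-identityˡ k ⟩
        value k ∎)

theorem4 : ∀ {a ℓ₁ ℓ₂} (K : OrderedField a ℓ₁ ℓ₂) → let open Grids K in
    (c : ℕ) (0<c : 0 < c) →
    ( (∀ i (1≤i : 1 ≤ i) (i≤c : i ≤ c) →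
    t c i 1≤i i≤c ≃ (ι 1 ÷ ι i {{>-nonZero 1≤i}}) *⁺ t c 1 ≤-refl 0<c)
    × t c 1 ≤-refl 0<c ≃ ι c {{>-nonZero 0<c}} ÷ ι (1 + 2 * c) )
    × (∀ i (1≤i : 1 ≤ i) (i≤c : i ≤ c) → EdgeRatios i (reduced c i i≤c))
    × (∀ i (1≤i : 1 ≤ i) (i<c : i < c) (X : Side) r d (p : IsCell i r d) →
    reduced c i (<⇒≤ i<c) X r d p ≃ f c i 1≤i i<c *⁺ initial i X r d p)
theorem4 K c@(suc m) 0<c =
  ( (λ i 1≤i i≤c → tail-ratio m i 1≤i i≤c 0<c) , tail-1 m 0<c )
  , (λ i 1≤i i≤c →
       proportional⇒edgeRatios ((ι c ÷ odd c) ÷ h i) (reduced c i i≤c) (reduced-proportional m i i≤c))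
  , reduced-initial m
  where
  open Grids K
  open SemifieldProperties K
  open GridProperties K
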